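{- Let $k$ be an odd positive integer, let $1\leq\ell_1\leq\ell_2\leq\ell_3\leq\ell_4$ be integers and $n=\ell_1+\ell_2+\ell_3+\ell_4$. If $n\geq7$, then the spider graph $S_{\ell_1,\ell_2,\ell_3,\ell_4}$ can be embedded in $K_k^*$ if and only if either (a) $\ell_3=1$ and $n\leq\binom{k+1}{2}-1$, or (b) $\ell_3\geq2$ and $n\leq\binom{k+1}{2}$.
   Context: $K_k^*$ denotes the complete graph $K_k$ on vertices $v_0,\dotsc,v_{k-1}$ with a loop $v_iv_i$ added at every vertex. An embedding of a graph $G$ in $K_k^*$ is a map $f:V(G)\to V(K_k^*)$ such that each edge $uv$ of $G$ is sent to the edge $f(u)f(v)$ of $K_k^*$ (a loop if $f(u)=f(v)$), and the induced map $E(G)\to E(K_k^*)$ is injective. The spider graph $S_{\ell_1,\dotsc,\ell_\Delta}$ ($\ell_1\leq\dotsb\leq\ell_\Delta$ positive integers) is the tree with central vertex $x_0$ and, for each $i$, a path $x_0x^i_1x^i_2\dotsb x^i_{\ell_i}$ (the $i$-th leg, with $\ell_i$ edges), the legs sharing only $x_0$. -}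

module Defs where

open import Data.Nat using (ℕ; zero; suc; _+_; _*_)
open import Data.Fin using (Fin; zero; suc; inject₁)
open import Data.Vec using (Vec; lookup)
open import Data.Product using (Σ; ∃; _×_)
open import Data.Sum using (_⊎_)
open import Relation.Binary.PropositionalEquality using (_≡_)

Odd : ℕ → Set
Odd k = ∃ λ m → k ≡ suc (2 * m)

-- Vertices of the spider S_{ls}: the centre x₀, and for leg i (i : Fin d)
-- and j : Fin (ls i) the vertex x^i_{j+1}.
data SpiderVertex {d : ℕ} (ls : Vec ℕ d) : Set where
  centre : SpiderVertex ls
  legv   : (i : Fin d) → Fin (lookup ls i) → SpiderVertex ls

-- Edges of the spider: one edge per (leg i, position j), namely x^i_j x^i_{j+1}
-- (with x^i_0 = x₀).
SpiderEdge : {d : ℕ} → Vec ℕ d → Set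
SpiderEdge {d} ls = Σ (Fin d) λ i → Fin (lookup ls i)

prevOnLeg : {d : ℕ} {ls : Vec ℕ d} (i : Fin d) {m : ℕ} →
            (Fin m → Fin (lookup ls i)) → Fin m → SpiderVertex ls
prevOnLeg i emb zero    = centre
prevOnLeg i emb (suc j) = legv i (emb (inject₁ j))

edgeInner : {d : ℕ} {ls : Vec ℕ d} → SpiderEdge ls → SpiderVertex ls
edgeInner (i Data.Product., j) = prevOnLeg i (λ x → x) j

edgeOuter : {d : ℕ} {ls : Vec ℕ d} → SpiderEdge ls → SpiderVertex ls
edgeOuter (i Data.Product., j) = legv i j

-- Two (unordered) edges {a,b} and {c,d} of K_k^* coincide (loops allowed: a ≡ b).
SameKEdge : {k : ℕ} → Fin k → Fin k → Fin k → Fin k → Set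
SameKEdge a b c d = (a ≡ c × b ≡ d) ⊎ (a ≡ d × b ≡ c)

IsEmbedding : {d : ℕ} (ls : Vec ℕ d) (k : ℕ) → (SpiderVertex ls → Fin k) → Set
IsEmbedding ls k f =
  (e e′ : SpiderEdge ls) →
  SameKEdge (f (edgeInner e)) (f (edgeOuter e)) (f (edgeInner e′)) (f (edgeOuter e′)) →
  e ≡ e′

EmbedsIn : {d : ℕ} (ls : Vec ℕ d) (k : ℕ) → Set
EmbedsIn ls k = Σ (SpiderVertex ls → Fin k) λ f → IsEmbedding ls k f

{-# OPTIONS --safe #-}

-- Necessity.  An embedding uses each of the (k+1 choose 2) edges of K*_k at most once.  If it
-- uses all of them then, as all degrees of K*_k are even, the four ends of the legs coincide in
-- pairs; this is impossible for ℓ₃ = 1, as the ends of the three short legs are distinct.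
--
-- Sufficiency.  If K*_k has an Euler circuit at v that is back at v after m steps, then walking
-- along its two closed parts from both ends embeds every spider with ℓ₁ + ℓ₃ ≤ m and
-- ℓ₂ + ℓ₄ ≤ (k+1 choose 2) − m.  Such circuits exist for all odd k ≥ 5 and
-- 3 ≤ m ≤ (k+1 choose 2) − 3: append to the longer part a closed trail through the edges at two
-- new vertices.  Only k = 5, and m = 13, 14, 15 for k = 7, are not reached from k − 2.
module Submission where

open import Defs
open import Data.Nat
open import Data.Nat.Properties
open import Data.Nat.Combinatorics using (_C_; nC1≡n; nCk+nC[k+1]≡[n+1]C[k+1])
open import Data.Nat.Tactic.RingSolver using (solve-∀)
open import Data.Bool using (Bool; true; false; not; _xor_)
open import Data.Bool.Properties using (xor-comm; xor-assoc; not-involutive)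
open import Data.Fin using (Fin; zero; suc; toℕ; fromℕ<; inject₁)
open import Data.Fin.Patterns
import Data.Fin.Properties as Finₚ
open import Data.Vec using (Vec; lookup; _∷_; [])
open import Data.List.Base
  using (List; []; _∷_; _++_; length; map; concat; tabulate)
open import Data.List.Properties
  using (length-++; length-map; length-tabulate; ++-assoc; ++-identityʳ)
open import Data.List.Membership.Propositional using (_∈_)
open import Data.List.Membership.Propositional.Properties using (∈-∃++; ∈-++⁺ˡ; ∈-++⁺ʳ)
open import Data.List.Relation.Binary.Subset.Propositional using (_⊆_)
open import Data.List.Relation.Binary.Permutation.Propositional as ↭
  using (_↭_; ↭⇒↭ₛ; ↭-refl; ↭-trans)
import Data.List.Relation.Binary.Permutation.Propositional.Properties as Perm
import Data.List.Relation.Binary.Permutation.Setoid.Properties as PermSetoid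
open import Data.List.Relation.Unary.Any using (here; there)
open import Data.List.Relation.Unary.All as All using (All; []; _∷_)
import Data.List.Relation.Unary.All.Properties as Allₚ
open import Data.List.Relation.Unary.AllPairs as AllPairs using (AllPairs; []; _∷_; allPairs?)
import Data.List.Relation.Unary.AllPairs.Properties as AllPairsₚ
open import Data.List.Relation.Unary.Unique.Propositional using (Unique)
open import Data.Product using (_×_; _,_; proj₁; proj₂; ∃)
open import Data.Sum using (_⊎_; inj₁; inj₂; [_,_])
open import Function.Base using (_∘_; _∋_)
open import Function.Bundles using (_⇔_; mk⇔)
open import Relation.Binary.Definitions using (tri<; tri≈; tri>)
open import Relation.Binary.PropositionalEquality
  using (_≡_; _≢_; refl; sym; trans; cong; cong₂; subst; setoid; module ≡-Reasoning)
open import Relation.Nullary using (¬_; Dec; yes; no; ¬?; contradiction)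
open import Relation.Nullary.Decidable
  using (map′; _×-dec_; _⊎-dec_; True; toWitness; dec-true; dec-false; from-yes; from-no)

-- Unordered edges on the natural numbers

Edge : Set
Edge = ℕ × ℕ

data SameEdge : Edge → Edge → Set where
  same    : ∀ {a b} → SameEdge (a , b) (a , b)
  swapped : ∀ {a b} → SameEdge (a , b) (b , a)

SameEdge-sym : ∀ {e e′} → SameEdge e e′ → SameEdge e′ e
SameEdge-sym same    = same
SameEdge-sym swapped = swapped

SameEdge-trans : ∀ {e e′ e″} → SameEdge e e′ → SameEdge e′ e″ → SameEdge e e″
SameEdge-trans same    q       = q
SameEdge-trans swapped same    = swapped
SameEdge-trans swapped swapped = same

Distinct : Edge → Edge → Set
Distinct e e′ = ¬ SameEdge e e′

SameEdge⇒≡ : ∀ {a b c d} → SameEdge (a , b) (c , d) → (a ≡ c × b ≡ d) ⊎ (a ≡ d × b ≡ c)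
SameEdge⇒≡ same    = inj₁ (refl , refl)
SameEdge⇒≡ swapped = inj₂ (refl , refl)

distinct? : ∀ e e′ → Dec (Distinct e e′)
distinct? (a , b) (c , d) = ¬? (map′ to SameEdge⇒≡ ((a ≟ c ×-dec b ≟ d) ⊎-dec (a ≟ d ×-dec b ≟ c)))
  where
  to : (a ≡ c × b ≡ d) ⊎ (a ≡ d × b ≡ c) → SameEdge (a , b) (c , d)
  to (inj₁ (refl , refl)) = same
  to (inj₂ (refl , refl)) = swapped

Incident : ℕ → Edge → Set
Incident x (a , b) = a ≡ x ⊎ b ≡ x

incident-resp : ∀ {x e e′} → SameEdge e e′ → Incident x e → Incident x e′
incident-resp same    i        = i
incident-resp swapped (inj₁ p) = inj₂ p
incident-resp swapped (inj₂ p) = inj₁ p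

-- A vertex that lies on only one of two edges tells them apart; the distinctness proofs for the
-- detour all rest on such a witness `x`.
distinctˡ : ∀ x {e e′} → Incident x e → ¬ Incident x e′ → Distinct e e′
distinctˡ x i ¬i s = ¬i (incident-resp s i)

distinctʳ : ∀ x {e e′} → ¬ Incident x e → Incident x e′ → Distinct e e′
distinctʳ x ¬i i s = ¬i (incident-resp (SameEdge-sym s) i)

-- Walks and their edges

-- A walk is a start vertex together with the list of the vertices that follow it.

edges : ℕ → List ℕ → List Edge
edges v []       = []
edges v (x ∷ xs) = (v , x) ∷ edges x xs

endpoint : ℕ → List ℕ → ℕ
endpoint v []       = v
endpoint v (x ∷ xs) = endpoint x xs

edges-++ : ∀ v xs ys → edges v (xs ++ ys) ≡ edges v xs ++ edges (endpoint v xs) ys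
edges-++ v []       ys = refl
edges-++ v (x ∷ xs) ys = cong ((v , x) ∷_) (edges-++ x xs ys)

endpoint-++ : ∀ v xs ys → endpoint v (xs ++ ys) ≡ endpoint (endpoint v xs) ys
endpoint-++ v []       ys = refl
endpoint-++ v (x ∷ xs) ys = endpoint-++ x xs ys

-- The detour through two new vertices

-- The odd number 2h + 1, in a form where `order (suc h)` reduces to two more than `order h`, as in
-- the passage from K*_k to K*_{k+2}.
order : ℕ → ℕ
order zero    = 1
order (suc h) = 2 + order h

1≤order : ∀ h → 1 ≤ order h
1≤order zero    = s≤s z≤n
1≤order (suc h) = s≤s z≤n

-- The binomial coefficient (k+1 choose 2), which is the number of edges of K*_k with its loops.
triangle : ℕ → ℕ
triangle zero    = 0
triangle (suc k) = suc k + triangle k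

triangle-2+ : ∀ k → triangle (2 + k) ≡ 3 + (k + k) + triangle k
triangle-2+ k = lemma k (triangle k)
  where
  lemma : ∀ k t → (2 + k) + ((1 + k) + t) ≡ (3 + (k + k)) + t
  lemma = solve-∀

module Detour (a b : ℕ) (a<b : a < b) where

  -- The walk from `a` that finishes the detour once the step from 0 to `a` is made. The vertices
  -- `a` and `b` stay fixed while `j` decreases, which makes induction on `j` possible.
  zigzag : ℕ → List ℕ
  zigzag zero    = a ∷ b ∷ b ∷ 0 ∷ []
  zigzag (suc j) = order j ∷ b ∷ suc (order j) ∷ a ∷ zigzag j

  private
    avoid : ∀ {x p q} → p ≢ x → q ≢ x → ¬ Incident x (p , q)
    avoid p≢x q≢x = [ p≢x , q≢x ]

    a≢b : a ≢ b
    a≢b = <⇒≢ a<b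

    b≢a : b ≢ a
    b≢a = a≢b ∘ sym

  zigzag-length : ∀ j → length (zigzag j) ≡ 2 + (order j + order j)
  zigzag-length zero    = refl
  zigzag-length (suc j) rewrite zigzag-length j = lemma (order j)
    where
    lemma : ∀ o → 4 + (2 + (o + o)) ≡ 2 + (2 + o + (2 + o))
    lemma = solve-∀

  zigzag-endpoint : ∀ j → endpoint a (zigzag j) ≡ 0
  zigzag-endpoint zero    = refl
  zigzag-endpoint (suc j) = zigzag-endpoint j

  zigzag-bounded : ∀ {k} → b < k → ∀ j → order j ≤ a → All (_< k) (zigzag j)
  zigzag-bounded b<k zero    _   =
    <-trans a<b b<k ∷ b<k ∷ b<k ∷ ≤-<-trans z≤n b<k ∷ []
  zigzag-bounded b<k (suc j) o≤a =
    <-trans (n<1+n _) o+1<k ∷ b<k ∷ o+1<k ∷ <-trans a<b b<k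
      ∷ zigzag-bounded b<k j (<⇒≤ (<⇒≤ o≤a))
    where o+1<k = ≤-<-trans (<⇒≤ o≤a) (<-trans a<b b<k)

  zigzag-incident : ∀ j → All (λ e → Incident a e ⊎ Incident b e) (edges a (zigzag j))
  zigzag-incident zero    =
    inj₁ (inj₁ refl) ∷ inj₁ (inj₁ refl) ∷ inj₂ (inj₁ refl) ∷ inj₂ (inj₁ refl) ∷ []
  zigzag-incident (suc j) =
    inj₁ (inj₁ refl) ∷ inj₂ (inj₂ refl) ∷ inj₂ (inj₁ refl) ∷ inj₁ (inj₂ refl)
      ∷ zigzag-incident j

  -- Apart from `a` and `b`, only vertices below `order j` occur on `zigzag j`. Hence the four edges
  -- put in front of it at the next stage, each of which meets `order j` or its successor, are new.
  zigzag-avoids : ∀ j {x} → order j ≤ x → x ≢ a → x ≢ b →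
                  All (¬_ ∘ Incident x) (edges a (zigzag j))
  zigzag-avoids zero    o≤x x≢a x≢b =
    avoid (x≢a ∘ sym) (x≢a ∘ sym) ∷ avoid (x≢a ∘ sym) (x≢b ∘ sym)
      ∷ avoid (x≢b ∘ sym) (x≢b ∘ sym) ∷ avoid (x≢b ∘ sym) (<⇒≢ o≤x) ∷ []
  zigzag-avoids (suc j) o≤x x≢a x≢b =
    avoid (x≢a ∘ sym) (<⇒≢ (<⇒≤ o≤x)) ∷ avoid (<⇒≢ (<⇒≤ o≤x)) (x≢b ∘ sym)
      ∷ avoid (x≢b ∘ sym) (<⇒≢ o≤x) ∷ avoid (<⇒≢ o≤x) (x≢a ∘ sym)
      ∷ zigzag-avoids j (<⇒≤ (<⇒≤ o≤x)) x≢a x≢b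

  zigzag-trail : ∀ j → order j ≤ a → AllPairs Distinct (edges a (zigzag j))
  zigzag-trail zero    o≤a =
    (distinctʳ b (avoid a≢b a≢b) (inj₂ refl)
      ∷ distinctˡ a (inj₁ refl) (avoid b≢a b≢a)
      ∷ distinctˡ a (inj₁ refl) (avoid b≢a (<⇒≢ o≤a)) ∷ [])
    ∷ (distinctˡ a (inj₁ refl) (avoid b≢a b≢a)
      ∷ distinctˡ a (inj₁ refl) (avoid b≢a (<⇒≢ o≤a)) ∷ [])
    ∷ (distinctʳ 0 (avoid b≢0 b≢0) (inj₂ refl) ∷ [])
    ∷ [] ∷ []
    where
    b≢0 : b ≢ 0
    b≢0 = m<n⇒n≢0 a<b
  zigzag-trail (suc j) o≤a =
    (distinctˡ a (inj₁ refl) (avoid x≢a b≢a)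
      ∷ distinctˡ x (inj₂ refl) (avoid b≢x y≢x)
      ∷ distinctˡ x (inj₂ refl) (avoid y≢x (x≢a ∘ sym))
      ∷ All.map (distinctˡ x (inj₂ refl)) avoids-x)
    ∷ (distinctˡ x (inj₁ refl) (avoid b≢x y≢x)
      ∷ distinctˡ x (inj₁ refl) (avoid y≢x (x≢a ∘ sym))
      ∷ All.map (distinctˡ x (inj₁ refl)) avoids-x)
    ∷ (distinctˡ b (inj₁ refl) (avoid (<⇒≢ (<-trans o≤a a<b)) a≢b)
      ∷ All.map (distinctˡ y (inj₂ refl)) avoids-y)
    ∷ All.map (distinctˡ y (inj₁ refl)) avoids-y
    ∷ zigzag-trail j (<⇒≤ (<⇒≤ o≤a))
    where
    x = order j
    y = suc x
    x≢a : x ≢ a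
    x≢a = <⇒≢ (<⇒≤ o≤a)
    b≢x : b ≢ x
    b≢x = >⇒≢ (<-trans (<⇒≤ o≤a) a<b)
    y≢x : y ≢ x
    y≢x = >⇒≢ (n<1+n x)
    avoids-x = zigzag-avoids j ≤-refl x≢a (b≢x ∘ sym)
    avoids-y = zigzag-avoids j (n≤1+n x) (<⇒≢ o≤a) (<⇒≢ (<-trans o≤a a<b))

  -- The only edge of `zigzag j` at 0 is its last one, from `b` to 0, and it misses `a`.
  zigzag-distinct-0a : 0 < a → ∀ j → All (Distinct (0 , a)) (edges a (zigzag j))
  zigzag-distinct-0a 0<a zero    =
    distinctˡ 0 (inj₁ refl) (avoid a≢0 a≢0) ∷ distinctˡ 0 (inj₁ refl) (avoid a≢0 b≢0)
      ∷ distinctˡ 0 (inj₁ refl) (avoid b≢0 b≢0)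
      ∷ distinctˡ a (inj₂ refl) (avoid b≢a (a≢0 ∘ sym)) ∷ []
    where
    a≢0 : a ≢ 0
    a≢0 = >⇒≢ 0<a
    b≢0 : b ≢ 0
    b≢0 = m<n⇒n≢0 a<b
  zigzag-distinct-0a 0<a (suc j) =
    distinctˡ 0 (inj₁ refl) (avoid a≢0 o≢0) ∷ distinctˡ 0 (inj₁ refl) (avoid o≢0 b≢0)
      ∷ distinctˡ 0 (inj₁ refl) (avoid b≢0 λ ()) ∷ distinctˡ 0 (inj₁ refl) (avoid (λ ()) a≢0)
      ∷ zigzag-distinct-0a 0<a j
    where
    a≢0 : a ≢ 0
    a≢0 = >⇒≢ 0<a
    b≢0 : b ≢ 0
    b≢0 = m<n⇒n≢0 a<b
    o≢0 : order j ≢ 0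
    o≢0 = >⇒≢ (1≤order j)

-- With a = k and b = k + 1, the closed trail 0 a x b y a x′ b y′ a ⋯ a a b b 0, where
-- (x , y) = (2j + 1 , 2j + 2) for j = h - 1, …, 0, traverses the 2k + 3 edges of K*_{k+2} that
-- are not in K*_k.
module _ (h : ℕ) where

  private
    k = order h
    open Detour k (suc k) (n<1+n k)

  detour : List ℕ
  detour = k ∷ zigzag h

  detour-length : length detour ≡ 3 + (k + k)
  detour-length = cong suc (zigzag-length h)

  detour-endpoint : endpoint 0 detour ≡ 0
  detour-endpoint = zigzag-endpoint h

  detour-bounded : All (_< 2 + k) detour
  detour-bounded = s≤s (n≤1+n k) ∷ zigzag-bounded (n<1+n _) h ≤-refl

  detour-trail : AllPairs Distinct (edges 0 detour)
  detour-trail = zigzag-distinct-0a (1≤order h) h ∷ zigzag-trail h ≤-refl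

  -- Each edge of the detour meets `k` or `suc k`, and neither is a vertex of K*_k.
  detour-new : ∀ {p q} → p < k → q < k → All (Distinct (p , q)) (edges 0 detour)
  detour-new {p} {q} p<k q<k = All.map new (inj₁ (inj₂ refl) ∷ zigzag-incident h)
    where
    old : ∀ {x} → k ≤ x → ¬ Incident x (p , q)
    old k≤x (inj₁ refl) = <-irrefl refl (<-≤-trans p<k k≤x)
    old k≤x (inj₂ refl) = <-irrefl refl (<-≤-trans q<k k≤x)
    new : ∀ {e} → Incident k e ⊎ Incident (suc k) e → Distinct (p , q) e
    new (inj₁ i) = distinctʳ k (old ≤-refl) i
    new (inj₂ i) = distinctʳ (suc k) (old (n≤1+n k)) i

-- Euler circuits cut into two closed trails

edges-bounded : ∀ {k} v xs → v < k → All (_< k) xs →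
                All (λ e → proj₁ e < k × proj₂ e < k) (edges v xs)
edges-bounded v []       v<k []           = []
edges-bounded v (x ∷ xs) v<k (x<k ∷ xs<k) = (v<k , x<k) ∷ edges-bounded x xs x<k xs<k

-- For m + n = `triangle k` this is an Euler circuit of K*_k at 0, cut at a return to 0 after `m`
-- steps.
record Tour (k m n : ℕ) : Set where
  field
    first second     : List ℕ
    first-length     : length first ≡ m
    second-length    : length second ≡ n
    first-endpoint   : endpoint 0 first ≡ 0
    second-endpoint  : endpoint 0 second ≡ 0
    first-bounded    : All (_< k) first
    second-bounded   : All (_< k) second
    trail            : AllPairs Distinct (edges 0 first ++ edges 0 second)

swap-tour : ∀ {k m n} → Tour k m n → Tour k n m
swap-tour t = record
  { first = second ; second = first
  ; first-length = second-length ; second-length = first-length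
  ; first-endpoint = second-endpoint ; second-endpoint = first-endpoint
  ; first-bounded = second-bounded ; second-bounded = first-bounded
  ; trail = PermSetoid.AllPairs-resp-↭ (setoid Edge) (_∘ SameEdge-sym)
              ((λ { refl d → d }) , (λ { refl d → d }))
              (↭⇒↭ₛ (Perm.++-comm (edges 0 first) (edges 0 second))) trail
  }
  where open Tour t

-- The detour starts and ends at 0, where `second` has ended, and its edges are not in K*_k; so it
-- can be appended to `second`.
extend-tour : ∀ h {m n} → Tour (order h) m n →
              Tour (order (suc h)) m (n + (3 + (order h + order h)))
extend-tour h {m} {n} t = record
  { first = first ; second = second ++ detour h
  ; first-length = first-length
  ; second-length = trans (length-++ second) (cong₂ _+_ second-length (detour-length h))
  ; first-endpoint = first-endpoint
  ; second-endpoint =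
      trans (endpoint-++ 0 second (detour h))
        (trans (cong (λ v → endpoint v (detour h)) second-endpoint) (detour-endpoint h))
  ; first-bounded = weaken first-bounded
  ; second-bounded = Allₚ.++⁺ (weaken second-bounded) (detour-bounded h)
  ; trail = subst (AllPairs Distinct) regroup
      (AllPairsₚ.++⁺ trail (detour-trail h)
        (All.map (λ (p<k , q<k) → detour-new h p<k q<k)
          (Allₚ.++⁺ (edges-bounded 0 first (1≤order h) first-bounded)
                    (edges-bounded 0 second (1≤order h) second-bounded))))
  }
  where
  open Tour t
  weaken : ∀ {xs} → All (_< order h) xs → All (_< order (suc h)) xs
  weaken = All.map (λ p → ≤-trans p (m≤n+m _ 2))
  regroup : (edges 0 first ++ edges 0 second) ++ edges 0 (detour h)
          ≡ edges 0 first ++ edges 0 (second ++ detour h)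
  regroup = trans (++-assoc (edges 0 first) _ _) (cong (edges 0 first ++_)
    (sym (trans (edges-++ 0 second (detour h))
      (cong (λ v → edges 0 second ++ edges v (detour h)) second-endpoint))))

-- All conditions on a tour are decidable, so for concrete lists the implicit argument is settled by
-- evaluation.
explicit : ∀ {k m n} (xs ys : List ℕ) →
  {True (length xs ≟ m ×-dec length ys ≟ n ×-dec endpoint 0 xs ≟ 0 ×-dec endpoint 0 ys ≟ 0
         ×-dec All.all? (_<? k) xs ×-dec All.all? (_<? k) ys
         ×-dec allPairs? distinct? (edges 0 xs ++ edges 0 ys))} → Tour k m n
explicit xs ys {checked} with toWitness checked
... | lx , ly , ex , ey , bx , by , t = record
  { first = xs ; second = ys ; first-length = lx ; second-length = ly
  ; first-endpoint = ex ; second-endpoint = ey ; first-bounded = bx ; second-bounded = by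
  ; trail = t }

-- Found by computer search.

tour-5-3 : Tour 5 3 12
tour-5-3 = explicit (1 ∷ 2 ∷ 0 ∷ [])
  (3 ∷ 1 ∷ 1 ∷ 4 ∷ 3 ∷ 3 ∷ 2 ∷ 2 ∷ 4 ∷ 4 ∷ 0 ∷ 0 ∷ [])

tour-5-4 : Tour 5 4 11
tour-5-4 = explicit (2 ∷ 4 ∷ 3 ∷ 0 ∷ [])
  (4 ∷ 4 ∷ 1 ∷ 2 ∷ 2 ∷ 3 ∷ 3 ∷ 1 ∷ 1 ∷ 0 ∷ 0 ∷ [])

tour-5-5 : Tour 5 5 10
tour-5-5 = explicit (3 ∷ 1 ∷ 4 ∷ 4 ∷ 0 ∷ [])
  (2 ∷ 3 ∷ 3 ∷ 4 ∷ 2 ∷ 2 ∷ 1 ∷ 1 ∷ 0 ∷ 0 ∷ [])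

tour-5-6 : Tour 5 6 9
tour-5-6 = explicit (1 ∷ 1 ∷ 4 ∷ 2 ∷ 3 ∷ 0 ∷ [])
  (0 ∷ 2 ∷ 2 ∷ 1 ∷ 3 ∷ 3 ∷ 4 ∷ 4 ∷ 0 ∷ [])

tour-5-7 : Tour 5 7 8
tour-5-7 = explicit (0 ∷ 1 ∷ 1 ∷ 2 ∷ 2 ∷ 3 ∷ 0 ∷ [])
  (2 ∷ 4 ∷ 1 ∷ 3 ∷ 3 ∷ 4 ∷ 4 ∷ 0 ∷ [])

tour-7-13 : Tour 7 13 15
tour-7-13 = explicit (0 ∷ 3 ∷ 5 ∷ 6 ∷ 1 ∷ 5 ∷ 4 ∷ 4 ∷ 0 ∷ 6 ∷ 6 ∷ 2 ∷ 0 ∷ [])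
  (1 ∷ 4 ∷ 6 ∷ 3 ∷ 2 ∷ 4 ∷ 3 ∷ 3 ∷ 1 ∷ 1 ∷ 2 ∷ 2 ∷ 5 ∷ 5 ∷ 0 ∷ [])

tour-7-14 : Tour 7 14 14
tour-7-14 = explicit (5 ∷ 1 ∷ 1 ∷ 6 ∷ 4 ∷ 3 ∷ 6 ∷ 6 ∷ 2 ∷ 5 ∷ 5 ∷ 3 ∷ 1 ∷ 0 ∷ [])
  (4 ∷ 4 ∷ 5 ∷ 6 ∷ 0 ∷ 2 ∷ 2 ∷ 1 ∷ 4 ∷ 2 ∷ 3 ∷ 3 ∷ 0 ∷ 0 ∷ [])

-- Tours of all lengths for odd k ≥ 5

-- The bound 3 excludes length 2: a closed walk of two edges uses the same edge twice.
AllTours : ℕ → Set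
AllTours k = ∀ m n → 3 ≤ m → 3 ≤ n → m + n ≡ triangle k → Tour k m n

symmetric-tours : ∀ {k} → (∀ m n → 3 ≤ m → m ≤ n → m + n ≡ triangle k → Tour k m n) → AllTours k
symmetric-tours T m n 3≤m 3≤n eq with ≤-total m n
... | inj₁ m≤n = T m n 3≤m m≤n eq
... | inj₂ n≤m = swap-tour (T n m 3≤n n≤m (trans (+-comm n m) eq))

-- The detour takes 3 + 2k of the `n` edges, and the bound on `n` leaves at least 3 for the second
-- trail in K*_k.
step-tours : ∀ h → AllTours (order h) → ∀ m n → 3 ≤ m → 6 + (order h + order h) ≤ n →
             m + n ≡ triangle (order (suc h)) → Tour (order (suc h)) m n
step-tours h T m n 3≤m le eq with m≤n⇒∃[o]m+o≡n le
... | d , refl = subst (Tour _ m) (shuffle k d)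
  (extend-tour h (T m (3 + d) 3≤m (m≤m+n 3 d) sum))
  where
  k = order h
  shuffle : ∀ k d → (3 + d) + (3 + (k + k)) ≡ (6 + (k + k)) + d
  shuffle = solve-∀
  left : ∀ m k d → (3 + (k + k)) + (m + (3 + d)) ≡ m + (6 + (k + k) + d)
  left = solve-∀
  sum : m + (3 + d) ≡ triangle k
  sum = +-cancelˡ-≡ (3 + (k + k)) _ _ (trans (left m k d) (trans eq (triangle-2+ k)))

tours₅ : AllTours 5
tours₅ = symmetric-tours base
  where
  base : ∀ m n → 3 ≤ m → m ≤ n → m + n ≡ 15 → Tour 5 m n
  base 0 _ () _ _
  base 1 _ (s≤s ()) _ _
  base 2 _ (s≤s (s≤s ())) _ _
  base 3 _ _ _ refl = tour-5-3
  base 4 _ _ _ refl = tour-5-4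
  base 5 _ _ _ refl = tour-5-5
  base 6 _ _ _ refl = tour-5-6
  base 7 _ _ _ refl = tour-5-7
  base m@(suc (suc (suc (suc (suc (suc (suc (suc m′)))))))) n _ m≤n eq =
    contradiction (subst (16 ≤_) eq (+-mono-≤ 8≤m (≤-trans 8≤m m≤n))) (from-no (16 ≤? 15))
    where
    8≤m : 8 ≤ m
    8≤m = m≤m+n 8 m′

tours₇ : AllTours 7
tours₇ = symmetric-tours base
  where
  base : ∀ m n → 3 ≤ m → m ≤ n → m + n ≡ 28 → Tour 7 m n
  -- Here 16 = 6 + 2 · 5 is the bound of `step-tours` for K*_5. Otherwise m ≤ n ≤ 15 and m + n = 28
  -- leave only m = 13 and m = 14.
  base m n 3≤m m≤n eq with 16 ≤? n
  ... | yes 16≤n = step-tours 2 tours₅ m n 3≤m 16≤n eq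
  ... | no  n≱16 with <-cmp m 13 | <-cmp m 14
  ... | tri≈ _ refl _ | _ = subst (Tour 7 13) (sym (+-cancelˡ-≡ 13 n 15 eq)) tour-7-13
  ... | _ | tri≈ _ refl _ = subst (Tour 7 14) (sym (+-cancelˡ-≡ 14 n 14 eq)) tour-7-14
  ... | tri< m<13 _ _ | _ =
    contradiction (subst (_≤ 27) eq (+-mono-≤ (s≤s⁻¹ m<13) (s≤s⁻¹ (≰⇒> n≱16)))) (from-no (28 ≤? 27))
  ... | tri> _ _ 13<m | tri< m<14 _ _ = contradiction m<14 (≤⇒≯ 13<m)
  ... | _ | tri> _ _ 14<m =
    contradiction (subst (30 ≤_) eq (+-mono-≤ 14<m (≤-trans 14<m m≤n))) (from-no (30 ≤? 28))

-- This ensures 2(5 + 2k) < `triangle (2 + k)`, so that the longer of two parts in K*_{k+2} has the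
-- 6 + 2k edges that `step-tours` asks for. It holds from k = 7 on; for k = 5 it would read 18 ≤ 15,
-- hence the separate tours of K*_7.
triangle-growth : ∀ g → 8 + (order (3 + g) + order (3 + g)) ≤ triangle (order (3 + g))
triangle-growth zero    = from-yes (22 ≤? 28)
triangle-growth (suc g) = begin
  8 + ((2 + k) + (2 + k))                   ≡⟨ left k ⟩
  4 + (8 + (k + k))                         ≤⟨ +-mono-≤ 4≤3+k+k (triangle-growth g) ⟩
  (3 + (k + k)) + triangle k                ≡⟨ triangle-2+ k ⟨
  triangle (2 + k)                          ∎
  where
  open ≤-Reasoning
  k = order (3 + g)
  4≤3+k+k : 4 ≤ 3 + (k + k)
  4≤3+k+k = +-monoʳ-≤ 3 (≤-trans (1≤order (3 + g)) (m≤m+n k k))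
  left : ∀ k → 8 + ((2 + k) + (2 + k)) ≡ 4 + (8 + (k + k))
  left = solve-∀

tours : ∀ g → AllTours (order (2 + g))
tours zero          = tours₅
tours (suc zero)    = tours₇
tours (suc (suc g)) = symmetric-tours λ m n 3≤m m≤n eq →
  step-tours (3 + g) (tours (suc g)) m n 3≤m (large m≤n eq) eq
  where
  k = order (3 + g)
  large : ∀ {m n} → m ≤ n → m + n ≡ triangle (2 + k) → 6 + (k + k) ≤ n
  large {m} {n} m≤n eq = ≮⇒≥ λ n<6+k+k → <-irrefl eq (let n≤5+k+k = s≤s⁻¹ n<6+k+k in begin-strict
    m + n                          ≤⟨ +-mono-≤ (≤-trans m≤n n≤5+k+k) n≤5+k+k ⟩
    (5 + (k + k)) + (5 + (k + k))  ≡⟨ left k ⟩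
    2 + (k + k) + (8 + (k + k))    <⟨ +-mono-<-≤ (n<1+n (2 + (k + k))) (triangle-growth g) ⟩
    (3 + (k + k)) + triangle k     ≡⟨ triangle-2+ k ⟨
    triangle (2 + k)               ∎)
    where
    open ≤-Reasoning
    left : ∀ k → (5 + (k + k)) + (5 + (k + k)) ≡ 2 + (k + k) + (8 + (k + k))
    left = solve-∀

-- Embedding a spider along a tour

-- Beyond its end the walk rests at its last vertex, so all values obey the bound on the vertices of
-- the walk.
vertexAt : ℕ → List ℕ → ℕ → ℕ
vertexAt v xs       zero    = v
vertexAt v []       (suc i) = v
vertexAt v (x ∷ xs) (suc i) = vertexAt x xs i

vertexAt-length : ∀ v xs → vertexAt v xs (length xs) ≡ endpoint v xs
vertexAt-length v []       = refl
vertexAt-length v (x ∷ xs) = vertexAt-length x xs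

vertexAt-++ : ∀ v xs ys → vertexAt v (xs ++ ys) (length xs) ≡ endpoint v xs
vertexAt-++ v []       ys = refl
vertexAt-++ v (x ∷ xs) ys = vertexAt-++ x xs ys

vertexAt-bounded : ∀ {k v xs} → v < k → All (_< k) xs → ∀ i → vertexAt v xs i < k
vertexAt-bounded v<k xs<k         zero    = v<k
vertexAt-bounded v<k []           (suc i) = v<k
vertexAt-bounded v<k (x<k ∷ xs<k) (suc i) = vertexAt-bounded x<k xs<k i

edgeAt : ℕ → List ℕ → ℕ → Edge
edgeAt v xs i = vertexAt v xs i , vertexAt v xs (suc i)

edgeAt-lookup : ∀ {P : Edge → Set} v xs → All P (edges v xs) →
                ∀ {i} → i < length xs → P (edgeAt v xs i)
edgeAt-lookup v (x ∷ xs) (p ∷ ps) {zero}  _         = p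
edgeAt-lookup v (x ∷ xs) (p ∷ ps) {suc i} (s≤s i<n) = edgeAt-lookup x xs ps i<n

edgeAt-distinct : ∀ v xs → AllPairs Distinct (edges v xs) → ∀ {i j} → i < j → j < length xs →
                  Distinct (edgeAt v xs i) (edgeAt v xs j)
edgeAt-distinct v (x ∷ xs) (d ∷ ds) {zero}  {suc j} _         (s≤s j<n) = edgeAt-lookup x xs d j<n
edgeAt-distinct v (x ∷ xs) (d ∷ ds) {suc i} {suc j} (s≤s i<j) (s≤s j<n) =
  edgeAt-distinct x xs ds i<j j<n

edgeAt-injective : ∀ v xs → AllPairs Distinct (edges v xs) →
                   ∀ {i j} → i < length xs → j < length xs →
                   SameEdge (edgeAt v xs i) (edgeAt v xs j) → i ≡ j
edgeAt-injective v xs t {i} {j} i<n j<n s with <-cmp i j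
... | tri< i<j _ _ = contradiction s (edgeAt-distinct v xs t i<j j<n)
... | tri≈ _ i≡j _ = i≡j
... | tri> _ _ j<i = contradiction (SameEdge-sym s) (edgeAt-distinct v xs t j<i i<n)

-- Legs 1 and 3 (indices 0F and 2F) follow the first closed trail from its two ends, legs 2
-- and 4 the second one.
module _ {k : ℕ} (w : ℕ → ℕ) (w<k : ∀ i → w i < k) {m N : ℕ} (w-m : w m ≡ w 0) (w-N : w N ≡ w 0)
         (w-injective : ∀ {i j} → i < N → j < N →
                        SameEdge (w i , w (suc i)) (w j , w (suc j)) → i ≡ j)
         {l₁ l₂ l₃ l₄ : ℕ} (l₁+l₃≤m : l₁ + l₃ ≤ m) (m+l₂+l₄≤N : m + (l₂ + l₄) ≤ N) where

  private
    ls : Vec ℕ 4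
    ls = l₁ ∷ l₂ ∷ l₃ ∷ l₄ ∷ []

    -- The time at which the circuit visits the vertex at distance `t` from the centre on the given
    -- leg; legs 3 and 4 run backwards in time.
    position : Fin 4 → ℕ → ℕ
    position 0F t = t
    position 1F t = m + t
    position 2F t = m ∸ t
    position 3F t = N ∸ t

    -- An edge of the circuit is numbered by the time of its earlier end, hence `suc t` on the two
    -- backward legs.
    index : Fin 4 → ℕ → ℕ
    index 0F t = t
    index 1F t = m + t
    index 2F t = m ∸ suc t
    index 3F t = N ∸ suc t

    -- The edge numbers of each leg lie in the half-open interval from `lower` to `upper`. The four
    -- intervals are disjoint and follow each other in the order 0F, 2F, 1F, 3F.
    lower upper : Fin 4 → ℕ
    lower 0F = 0
    lower 1F = m
    lower 2F = l₁
    lower 3F = m + l₂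
    upper 0F = l₁
    upper 1F = m + l₂
    upper 2F = m
    upper 3F = N

    m+l₂≤N : m + l₂ ≤ N
    m+l₂≤N = ≤-trans (+-monoʳ-≤ m (m≤m+n l₂ l₄)) m+l₂+l₄≤N
    l₁≤m : l₁ ≤ m
    l₁≤m = ≤-trans (m≤m+n l₁ l₃) l₁+l₃≤m
    m≤N : m ≤ N
    m≤N = ≤-trans (m≤m+n m l₂) m+l₂≤N
    l₃≤m : l₃ ≤ m
    l₃≤m = ≤-trans (m≤n+m l₃ l₁) l₁+l₃≤m
    m+l₂+l₄≤N′ : m + l₂ + l₄ ≤ N
    m+l₂+l₄≤N′ = subst (_≤ N) (sym (+-assoc m l₂ l₄)) m+l₂+l₄≤N
    l₄≤N : l₄ ≤ N
    l₄≤N = ≤-trans (m≤n+m l₄ (m + l₂)) m+l₂+l₄≤N′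

    descend : ∀ {a b c t} → a + c ≤ b → t < c → a ≤ b ∸ suc t
    descend {a} a+c≤b t<c =
      m+n≤o⇒m≤o∸n a (≤-trans (+-monoʳ-≤ a t<c) a+c≤b)

    descend-< : ∀ {b c t} → c ≤ b → t < c → b ∸ suc t < b
    descend-< c≤b t<c = ∸-monoʳ-< (s≤s z≤n) (≤-trans t<c c≤b)

    lower≤index : ∀ i (j : Fin (lookup ls i)) → lower i ≤ index i (toℕ j)
    lower≤index 0F j = z≤n
    lower≤index 1F j = m≤m+n m _
    lower≤index 2F j = descend l₁+l₃≤m (Finₚ.toℕ<n j)
    lower≤index 3F j = descend m+l₂+l₄≤N′ (Finₚ.toℕ<n j)

    index<upper : ∀ i (j : Fin (lookup ls i)) → index i (toℕ j) < upper i
    index<upper 0F j = Finₚ.toℕ<n j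
    index<upper 1F j = +-monoʳ-< m (Finₚ.toℕ<n j)
    index<upper 2F j = descend-< l₃≤m (Finₚ.toℕ<n j)
    index<upper 3F j = descend-< l₄≤N (Finₚ.toℕ<n j)

    upper≤N : ∀ i → upper i ≤ N
    upper≤N 0F = ≤-trans l₁≤m m≤N
    upper≤N 1F = m+l₂≤N
    upper≤N 2F = m≤N
    upper≤N 3F = ≤-refl

    index<N : ∀ i (j : Fin (lookup ls i)) → index i (toℕ j) < N
    index<N i j = <-≤-trans (index<upper i j) (upper≤N i)

    apart : ∀ i i′ {j j′} → upper i ≤ lower i′ →
            index i (toℕ {lookup ls i} j) ≢ index i′ (toℕ {lookup ls i′} j′)
    apart i i′ {j} {j′} u≤l = <⇒≢ (<-≤-trans (index<upper i j) (≤-trans u≤l (lower≤index i′ j′)))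

    index-injective : ∀ i i′ (j : Fin (lookup ls i)) (j′ : Fin (lookup ls i′)) →
                      index i (toℕ j) ≡ index i′ (toℕ j′) → (SpiderEdge ls ∋ (i , j)) ≡ (i′ , j′)
    index-injective 0F 0F j j′ eq = cong (0F ,_) (Finₚ.toℕ-injective eq)
    index-injective 1F 1F j j′ eq = cong (1F ,_) (Finₚ.toℕ-injective (+-cancelˡ-≡ m _ _ eq))
    index-injective 2F 2F j j′ eq = cong (2F ,_) (Finₚ.toℕ-injective (suc-injective
      (∸-cancelˡ-≡ (≤-trans (Finₚ.toℕ<n j) l₃≤m) (≤-trans (Finₚ.toℕ<n j′) l₃≤m) eq)))
    index-injective 3F 3F j j′ eq = cong (3F ,_) (Finₚ.toℕ-injective (suc-injective
      (∸-cancelˡ-≡ (≤-trans (Finₚ.toℕ<n j) l₄≤N) (≤-trans (Finₚ.toℕ<n j′) l₄≤N) eq)))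
    index-injective 0F 1F j j′ eq = contradiction eq (apart 0F 1F {j} {j′} l₁≤m)
    index-injective 0F 2F j j′ eq = contradiction eq (apart 0F 2F {j} {j′} ≤-refl)
    index-injective 0F 3F j j′ eq =
      contradiction eq (apart 0F 3F {j} {j′} (≤-trans l₁≤m (m≤m+n m l₂)))
    index-injective 2F 1F j j′ eq = contradiction eq (apart 2F 1F {j} {j′} ≤-refl)
    index-injective 2F 3F j j′ eq = contradiction eq (apart 2F 3F {j} {j′} (m≤m+n m l₂))
    index-injective 1F 3F j j′ eq = contradiction eq (apart 1F 3F {j} {j′} ≤-refl)
    index-injective 1F 0F j j′ eq = sym (index-injective 0F 1F j′ j (sym eq))
    index-injective 2F 0F j j′ eq = sym (index-injective 0F 2F j′ j (sym eq))
    index-injective 3F 0F j j′ eq = sym (index-injective 0F 3F j′ j (sym eq))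
    index-injective 1F 2F j j′ eq = sym (index-injective 2F 1F j′ j (sym eq))
    index-injective 3F 2F j j′ eq = sym (index-injective 2F 3F j′ j (sym eq))
    index-injective 3F 1F j j′ eq = sym (index-injective 1F 3F j′ j (sym eq))

    image : SpiderVertex ls → ℕ
    image centre     = w 0
    image (legv i j) = w (position i (suc (toℕ j)))

    image<k : ∀ x → image x < k
    image<k centre     = w<k _
    image<k (legv i j) = w<k _

    w-position-0 : ∀ i → w 0 ≡ w (position i 0)
    w-position-0 0F = refl
    w-position-0 1F = trans (sym w-m) (cong w (sym (+-identityʳ m)))
    w-position-0 2F = sym w-m
    w-position-0 3F = sym w-N

    -- General in `emb`, because an element of `Fin (lookup ls i)` cannot be matched while `i` is a
    -- variable. The case `zero` holds since the circuit is at the centre at times 0, `m` and `N`.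
    image-prevOnLeg : ∀ i {p} (emb : Fin p → Fin (lookup ls i)) → (∀ x → toℕ (emb x) ≡ toℕ x) →
                      ∀ j → image (prevOnLeg i emb j) ≡ w (position i (toℕ j))
    image-prevOnLeg i emb emb-toℕ zero    = w-position-0 i
    image-prevOnLeg i emb emb-toℕ (suc j) =
      cong (w ∘ position i ∘ suc) (trans (emb-toℕ (inject₁ j)) (Finₚ.toℕ-inject₁ j))

    traverse : ∀ i (j : Fin (lookup ls i)) →
               SameEdge (w (position i (toℕ j)) , w (position i (suc (toℕ j))))
                        (w (index i (toℕ j)) , w (suc (index i (toℕ j))))
    traverse 0F j = same
    traverse 1F j rewrite +-suc m (toℕ j) = same
    -- By `toℕ j` < `l₃` ≤ `m`, the successor of `m ∸ suc (toℕ j)` is `m ∸ toℕ j`: the leg uses this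
    -- edge against its direction.
    traverse 2F j rewrite sym (+-∸-assoc 1 (≤-trans (Finₚ.toℕ<n j) l₃≤m)) = swapped
    traverse 3F j rewrite sym (+-∸-assoc 1 (≤-trans (Finₚ.toℕ<n j) l₄≤N)) = swapped

    image-edge : ∀ e → SameEdge (image (edgeInner e) , image (edgeOuter e))
                              (w (index (proj₁ e) (toℕ (proj₂ e))) ,
                               w (suc (index (proj₁ e) (toℕ (proj₂ e)))))
    image-edge (i , j) rewrite image-prevOnLeg i (λ x → x) (λ _ → refl) j = traverse i j

    embedding : SpiderVertex ls → Fin k
    embedding x = fromℕ< (image<k x)

    fromℕ<-SameKEdge : ∀ x y x′ y′ →
      SameKEdge (embedding x) (embedding y) (embedding x′) (embedding y′) →
      SameEdge (image x , image y) (image x′ , image y′)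
    fromℕ<-SameKEdge x y x′ y′ (inj₁ (p , q))
      rewrite Finₚ.fromℕ<-injective _ _ (image<k x) (image<k x′) p
            | Finₚ.fromℕ<-injective _ _ (image<k y) (image<k y′) q = same
    fromℕ<-SameKEdge x y x′ y′ (inj₂ (p , q))
      rewrite Finₚ.fromℕ<-injective _ _ (image<k x) (image<k y′) p
            | Finₚ.fromℕ<-injective _ _ (image<k y) (image<k x′) q = swapped

  closedTrails⇒embeds : EmbedsIn ls k
  closedTrails⇒embeds = embedding , λ where
    e@(i , j) e′@(i′ , j′) s → index-injective i i′ j j′
      (w-injective (index<N i j) (index<N i′ j′)
        (SameEdge-trans (SameEdge-sym (image-edge e))
          (SameEdge-trans
            (fromℕ<-SameKEdge (edgeInner e) (edgeOuter e) (edgeInner e′) (edgeOuter e′) s)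
            (image-edge e′))))

tour⇒embeds : ∀ {k m n l₁ l₂ l₃ l₄} → 1 ≤ k → Tour k m n → l₁ + l₃ ≤ m → l₂ + l₄ ≤ n →
              EmbedsIn (l₁ ∷ l₂ ∷ l₃ ∷ l₄ ∷ []) k
tour⇒embeds {m = m} 1≤k t le₁ le₂ =
  closedTrails⇒embeds (vertexAt 0 whole)
    (vertexAt-bounded 1≤k (Allₚ.++⁺ first-bounded second-bounded))
    (subst (λ i → vertexAt 0 whole i ≡ 0) first-length
      (trans (vertexAt-++ 0 first second) first-endpoint))
    (subst (λ i → vertexAt 0 whole i ≡ 0) whole-length
      (trans (vertexAt-length 0 whole) whole-endpoint))
    (λ i<N j<N → edgeAt-injective 0 whole whole-trail
      (subst (_ <_) (sym whole-length) i<N) (subst (_ <_) (sym whole-length) j<N))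
    le₁ (+-monoʳ-≤ m le₂)
  where
  open Tour t
  whole = first ++ second
  whole-length = trans (length-++ first) (cong₂ _+_ first-length second-length)
  whole-endpoint = trans (endpoint-++ 0 first second)
    (trans (cong (λ v → endpoint v second) first-endpoint) second-endpoint)
  whole-trail = subst (AllPairs Distinct)
    (sym (trans (edges-++ 0 first second)
      (cong (λ v → edges 0 first ++ edges v second) first-endpoint)))
    trail

-- Counting the edges of K*_k

-- The head of `xs` is moved to the front of `ys`; as it does not recur in `xs`, the tail of `xs` is
-- still contained in what remains. The list `zs` is the complement.
unique-⊆⇒↭ : ∀ {A : Set} {xs ys : List A} → Unique xs → xs ⊆ ys → ∃ λ zs → ys ↭ xs ++ zs
unique-⊆⇒↭ {xs = []}     {ys} []           _   = ys , ↭-refl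
unique-⊆⇒↭ {xs = x ∷ xs} {ys} (x∉xs ∷ uxs) sub with ∈-∃++ (sub (here refl))
... | as , bs , refl with unique-⊆⇒↭ uxs rest
  where
  rest : xs ⊆ as ++ bs
  rest y∈xs with Perm.∈-resp-↭ (Perm.shift x as bs) (sub (there y∈xs))
  ... | here refl = contradiction refl (All.lookup x∉xs y∈xs)
  ... | there y∈  = y∈
... | zs , p = zs , ↭-trans (Perm.shift x as bs) (↭.prep x p)

-- Puts the larger end first, as in `completeEdges`. Edges equal up to orientation thus become equal
-- pairs, and pigeonhole arguments on lists apply.
canonical : Edge → Edge
canonical (a , b) with ≤-total a b
... | inj₁ _ = b , a
... | inj₂ _ = a , b

canonical-same : ∀ e → SameEdge e (canonical e)
canonical-same (a , b) with ≤-total a b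
... | inj₁ _ = swapped
... | inj₂ _ = same

canonical-distinct : ∀ {e e′} → Distinct e e′ → canonical e ≢ canonical e′
canonical-distinct {e} {e′} d eq =
  d (SameEdge-trans (subst (SameEdge e) eq (canonical-same e)) (SameEdge-sym (canonical-same e′)))

row : ℕ → ℕ → List Edge
row k zero    = []
row k (suc m) = (k , m) ∷ row k m

completeEdges : ℕ → List Edge
completeEdges zero    = []
-- The bound `suc k` includes the loop at `k`.
completeEdges (suc k) = row k (suc k) ++ completeEdges k

row-length : ∀ k m → length (row k m) ≡ m
row-length k zero    = refl
row-length k (suc m) = cong suc (row-length k m)

completeEdges-length : ∀ k → length (completeEdges k) ≡ triangle k
completeEdges-length zero    = refl
completeEdges-length (suc k) =
  trans (length-++ (row k (suc k))) (cong₂ _+_ (row-length k (suc k)) (completeEdges-length k))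

∈-row : ∀ k {x m} → x < m → (k , x) ∈ row k m
∈-row k (s≤s x≤m) with m≤n⇒m<n∨m≡n x≤m
... | inj₁ x<m  = there (∈-row k x<m)
... | inj₂ refl = here refl

∈-completeEdges : ∀ {k x y} → x ≤ y → y < k → (y , x) ∈ completeEdges k
∈-completeEdges {suc k} x≤y (s≤s y≤k) with m≤n⇒m<n∨m≡n y≤k
... | inj₁ y<k  = ∈-++⁺ʳ (row k (suc k)) (∈-completeEdges x≤y y<k)
... | inj₂ refl = ∈-++⁺ˡ (∈-row k (s≤s x≤y))

canonical-∈ : ∀ {k} e → proj₁ e < k × proj₂ e < k → canonical e ∈ completeEdges k
canonical-∈ (a , b) (a<k , b<k) with ≤-total a b
... | inj₁ a≤b = ∈-completeEdges a≤b b<k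
... | inj₂ b≤a = ∈-completeEdges b≤a a<k

-- Parity of degrees in walks and in K*_k

-- Degrees modulo 2; a loop contributes 0.

flips : ℕ → Edge → Bool
flips u (a , b) = (a ≡ᵇ u) xor (b ≡ᵇ u)

degree : ℕ → List Edge → Bool
degree u []       = false
degree u (e ∷ es) = flips u e xor degree u es

≡ᵇ-true : ∀ u → (u ≡ᵇ u) ≡ true
≡ᵇ-true u = dec-true (u ≟ u) refl

≡ᵇ-false : ∀ {x u} → x ≢ u → (x ≡ᵇ u) ≡ false
≡ᵇ-false {x} {u} = dec-false (x ≟ u)

flips-resp : ∀ u {e e′} → SameEdge e e′ → flips u e ≡ flips u e′
flips-resp u same                = refl
flips-resp u (swapped {a} {b}) = xor-comm (a ≡ᵇ u) (b ≡ᵇ u)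

degree-++ : ∀ u es fs → degree u (es ++ fs) ≡ degree u es xor degree u fs
degree-++ u []       fs = refl
degree-++ u (e ∷ es) fs =
  trans (cong (flips u e xor_) (degree-++ u es fs)) (sym (xor-assoc (flips u e) _ _))

degree-↭ : ∀ u {es fs} → es ↭ fs → degree u es ≡ degree u fs
degree-↭ u ↭.refl          = refl
degree-↭ u (↭.prep e p)          = cong (flips u e xor_) (degree-↭ u p)
degree-↭ u (↭.swap {es} {fs} e f p) = begin
  flips u e xor (flips u f xor degree u es)  ≡⟨ xor-assoc (flips u e) (flips u f) _ ⟨
  (flips u e xor flips u f) xor degree u es
    ≡⟨ cong₂ _xor_ (xor-comm (flips u e) (flips u f)) (degree-↭ u p) ⟩
  (flips u f xor flips u e) xor degree u fs  ≡⟨ xor-assoc (flips u f) (flips u e) _ ⟩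
  flips u f xor (flips u e xor degree u fs)  ∎
  where open ≡-Reasoning
degree-↭ u (↭.trans p q)   = trans (degree-↭ u p) (degree-↭ u q)

degree-canonical : ∀ u es → degree u (map canonical es) ≡ degree u es
degree-canonical u []       = refl
degree-canonical u (e ∷ es) =
  cong₂ _xor_ (sym (flips-resp u (canonical-same e))) (degree-canonical u es)

-- Each inner visit to `u` contributes twice and cancels, so only the two ends count.
degree-edges : ∀ u v xs → degree u (edges v xs) ≡ (v ≡ᵇ u) xor (endpoint v xs ≡ᵇ u)
degree-edges u v []       = sym (lemma (v ≡ᵇ u))
  where
  lemma : ∀ p → p xor p ≡ false
  lemma false = refl
  lemma true  = refl
degree-edges u v (x ∷ xs) =
  trans (cong (flips u (v , x) xor_) (degree-edges u x xs)) (telescope (v ≡ᵇ u) (x ≡ᵇ u) _)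
  where
  telescope : ∀ p q r → (p xor q) xor (q xor r) ≡ p xor r
  telescope false false r     = refl
  telescope false true  false = refl
  telescope false true  true  = refl
  telescope true  false r     = refl
  telescope true  true  r     = refl

degree-avoids : ∀ {u es} → All (¬_ ∘ Incident u) es → degree u es ≡ false
degree-avoids []       = refl
degree-avoids (¬i ∷ a)
  rewrite ≡ᵇ-false (¬i ∘ inj₁) | ≡ᵇ-false (¬i ∘ inj₂) = degree-avoids a

row-avoids : ∀ {u k} m → k ≢ u → m ≤ u → All (¬_ ∘ Incident u) (row k m)
row-avoids zero    k≢u m≤u = []
row-avoids (suc m) k≢u m<u = [ k≢u , <⇒≢ m<u ] ∷ row-avoids m k≢u (<⇒≤ m<u)

completeEdges-avoids : ∀ {u} k → k ≤ u → All (¬_ ∘ Incident u) (completeEdges k)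
completeEdges-avoids zero    k≤u = []
completeEdges-avoids (suc k) k<u =
  Allₚ.++⁺ (row-avoids (suc k) (<⇒≢ k<u) k<u) (completeEdges-avoids k (<⇒≤ k<u))

degree-row : ∀ {u k} m → k ≢ u → u < m → degree u (row k m) ≡ true
degree-row {u} {k} (suc m) k≢u (s≤s u≤m) with m≤n⇒m<n∨m≡n u≤m
... | inj₁ u<m  rewrite ≡ᵇ-false k≢u | ≡ᵇ-false (>⇒≢ u<m) = degree-row m k≢u u<m
... | inj₂ refl rewrite ≡ᵇ-false k≢u | ≡ᵇ-true u | degree-avoids (row-avoids u k≢u ≤-refl) = refl

odd : ℕ → Bool
odd zero    = false
odd (suc n) = not (odd n)

odd-order : ∀ h → odd (order h) ≡ true
odd-order zero    = refl
odd-order (suc h) = trans (not-involutive _) (odd-order h)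

degree-row-self : ∀ {u} m → m ≤ u → degree u (row u m) ≡ odd m
degree-row-self     zero    m≤u = refl
degree-row-self {u} (suc m) m<u
  rewrite ≡ᵇ-true u | ≡ᵇ-false (<⇒≢ m<u) = cong not (degree-row-self m (<⇒≤ m<u))

-- Without its loop `u` has degree k - 1: its own row contributes `u` edges, and the row of each
-- later vertex contributes one.
degree-completeEdges : ∀ {u k} → u < k → degree u (completeEdges k) ≡ not (odd k)
degree-completeEdges {u} {suc k} (s≤s u≤k)
  rewrite degree-++ u (row k (suc k)) (completeEdges k) with m≤n⇒m<n∨m≡n u≤k
... | inj₁ u<k  rewrite degree-row (suc k) (>⇒≢ u<k) (s≤s u≤k) = cong not (degree-completeEdges u<k)
... | inj₂ refl rewrite ≡ᵇ-true u | degree-row-self u ≤-refl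
                      | degree-avoids (completeEdges-avoids u ≤-refl) = simplify (odd u)
  where
  simplify : ∀ p → p xor false ≡ not (not p)
  simplify false = refl
  simplify true  = refl

-- The edges used by an embedded spider

module EmbeddingEdges {d} (ls : Vec ℕ d) {k}
         (f : SpiderVertex ls → Fin k) (f-embeds : IsEmbedding ls k f) where

  imageEdge : SpiderEdge ls → Edge
  imageEdge e = toℕ (f (edgeInner e)) , toℕ (f (edgeOuter e))

  imageEdge-distinct : ∀ {e e′} → e ≢ e′ → Distinct (imageEdge e) (imageEdge e′)
  imageEdge-distinct {e} {e′} e≢e′ s with SameEdge⇒≡ s
  ... | inj₁ (p , q) = e≢e′ (f-embeds e e′ (inj₁ (Finₚ.toℕ-injective p , Finₚ.toℕ-injective q)))
  ... | inj₂ (p , q) = e≢e′ (f-embeds e e′ (inj₂ (Finₚ.toℕ-injective p , Finₚ.toℕ-injective q)))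

  legEdges : Fin d → List Edge
  legEdges i = tabulate λ j → imageEdge (i , j)

  imageEdges : List Edge
  imageEdges = concat (tabulate legEdges)

  imageEdges-distinct : AllPairs Distinct imageEdges
  imageEdges-distinct = AllPairsₚ.concat⁺
    (Allₚ.tabulate⁺ λ i → AllPairsₚ.tabulate⁺ λ j≢j′ → imageEdge-distinct λ { refl → j≢j′ refl })
    (AllPairsₚ.tabulate⁺ λ i≢i′ → Allₚ.tabulate⁺ λ j → Allₚ.tabulate⁺ λ j′ →
      imageEdge-distinct (i≢i′ ∘ cong proj₁))

  imageEdges-bounded : All (λ e → proj₁ e < k × proj₂ e < k) imageEdges
  imageEdges-bounded = Allₚ.concat⁺ {xss = tabulate legEdges}
    (Allₚ.tabulate⁺ λ i → Allₚ.tabulate⁺ λ j → Finₚ.toℕ<n (f (edgeInner (i , j)))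
                                             , Finₚ.toℕ<n (f (legv i j)))

  imageEdges-⊆ : ∃ λ es → completeEdges k ↭ map canonical imageEdges ++ es
  imageEdges-⊆ = unique-⊆⇒↭
    (AllPairsₚ.map⁺ (AllPairs.map canonical-distinct imageEdges-distinct))
    (All.lookup (Allₚ.map⁺ (All.map (canonical-∈ _) imageEdges-bounded)))

  imageEdges-length : ∃ λ es → completeEdges k ↭ map canonical imageEdges ++ es
                             × length imageEdges + length es ≡ triangle k
  imageEdges-length with imageEdges-⊆
  ... | es , p = es , p , trans (cong (_+ length es) (sym (length-map canonical imageEdges)))
    (trans (sym (length-++ (map canonical imageEdges)))
      (trans (sym (Perm.↭-length p)) (completeEdges-length k)))

  imageEdges-length≤ : length imageEdges ≤ triangle k
  imageEdges-length≤ with imageEdges-length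
  ... | es , _ , eq = subst (length imageEdges ≤_) eq (m≤m+n _ _)

  degree-imageEdges : length imageEdges ≡ triangle k →
                      ∀ u → degree u (completeEdges k) ≡ degree u imageEdges
  degree-imageEdges full u with imageEdges-length
  ... | []     , p , _  = trans (degree-↭ u p)
    (trans (cong (degree u) (++-identityʳ (map canonical imageEdges)))
      (degree-canonical u imageEdges))
  ... | _ ∷ es , _ , eq = contradiction (trans eq (sym full)) (m+1+n≢m (length imageEdges))

  centreImage : ℕ
  centreImage = toℕ (f centre)

  legVertices : Fin d → List ℕ
  legVertices i = tabulate λ j → toℕ (f (legv i j))

  -- The image of a leg is a walk from the image of the centre, so `degree-edges` applies.
  degree-legEdges : ∀ u i → degree u (legEdges i) ≡
                    (centreImage ≡ᵇ u) xor (endpoint centreImage (legVertices i) ≡ᵇ u)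
  degree-legEdges u i = trans
    (cong (degree u) (legEdges≡ centreImage (λ j → toℕ (f (legv i j))) _ (inner (λ j → j))))
    (degree-edges u centreImage (legVertices i))
    where
    predecessor : ∀ {m} → ℕ → (Fin m → ℕ) → Fin m → ℕ
    predecessor v g zero    = v
    predecessor v g (suc j) = g (inject₁ j)

    shift : ∀ {m} v (g : Fin (suc m) → ℕ) j →
            predecessor v g (suc j) ≡ predecessor (g zero) (g ∘ suc) j
    shift v g zero    = refl
    shift v g (suc j) = refl

    -- Arbitrary `v`, `g` and `p` let the induction remove the first edge and restart at `g zero`.
    legEdges≡ : ∀ {m} v (g : Fin m → ℕ) (p : Fin m → ℕ) → (∀ j → p j ≡ predecessor v g j) →
                tabulate (λ j → p j , g j) ≡ edges v (tabulate g)
    legEdges≡ {zero}  v g p eq = refl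
    legEdges≡ {suc m} v g p eq = cong₂ _∷_ (cong (_, g zero) (eq zero))
      (legEdges≡ (g zero) (g ∘ suc) (p ∘ suc) λ j → trans (eq (suc j)) (shift v g j))

    inner : ∀ {m} (emb : Fin m → Fin (lookup ls i)) j →
            toℕ (f (prevOnLeg i emb j)) ≡ predecessor centreImage (λ j → toℕ (f (legv i (emb j)))) j
    inner emb zero    = refl
    inner emb (suc j) = refl

module _ {l₁ l₂ l₃ l₄ k} (f : SpiderVertex (l₁ ∷ l₂ ∷ l₃ ∷ l₄ ∷ []) → Fin k)
         (f-embeds : IsEmbedding _ k f) where
  open EmbeddingEdges _ f f-embeds

  imageEdges-length₄ : length imageEdges ≡ l₁ + l₂ + l₃ + l₄
  imageEdges-length₄
    rewrite length-++ (legEdges 0F) {legEdges 1F ++ legEdges 2F ++ legEdges 3F ++ []}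
          | length-++ (legEdges 1F) {legEdges 2F ++ legEdges 3F ++ []}
          | length-++ (legEdges 2F) {legEdges 3F ++ []}
          | length-++ (legEdges 3F) {[]}
          | length-tabulate {n = l₁} (λ j → imageEdge (0F , j))
          | length-tabulate {n = l₂} (λ j → imageEdge (1F , j))
          | length-tabulate {n = l₃} (λ j → imageEdge (2F , j))
          | length-tabulate {n = l₄} (λ j → imageEdge (3F , j))
          | +-identityʳ l₄ | +-assoc (l₁ + l₂) l₃ l₄ = sym (+-assoc l₁ l₂ (l₃ + l₄))

  embeds⇒≤triangle : l₁ + l₂ + l₃ + l₄ ≤ triangle k
  embeds⇒≤triangle = subst (_≤ triangle k) imageEdges-length₄ imageEdges-length≤

module _ {l k} (f : SpiderVertex (1 ∷ 1 ∷ 1 ∷ l ∷ []) → Fin k)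
         (f-embeds : IsEmbedding _ k f) where
  open EmbeddingEdges _ f f-embeds

  private
    end : Fin 4 → ℕ
    end i = endpoint centreImage (legVertices i)

    -- The centre `c` enters once per leg, four times in all, and cancels. The final `false` comes
    -- from the empty list that ends `concat`.
    legsParity : (c p q r s : Bool) → Bool
    legsParity c p q r s = (c xor p) xor ((c xor q) xor ((c xor r) xor ((c xor s) xor false)))

    parity-1000 : ∀ c {p q r s} → p ≡ true → q ≡ false → r ≡ false → s ≡ false →
                  legsParity c p q r s ≡ true
    parity-1000 false refl refl refl refl = refl
    parity-1000 true  refl refl refl refl = refl

    parity-0100 : ∀ c {p q r s} → p ≡ false → q ≡ true → r ≡ false → s ≡ false →
                  legsParity c p q r s ≡ true
    parity-0100 false refl refl refl refl = refl
    parity-0100 true  refl refl refl refl = refl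

    degree≡ : ∀ u → degree u imageEdges ≡
      legsParity (centreImage ≡ᵇ u) (end 0F ≡ᵇ u) (end 1F ≡ᵇ u) (end 2F ≡ᵇ u) (end 3F ≡ᵇ u)
    degree≡ u
      rewrite degree-++ u (legEdges 0F) (legEdges 1F ++ legEdges 2F ++ legEdges 3F ++ [])
            | degree-++ u (legEdges 1F) (legEdges 2F ++ legEdges 3F ++ [])
            | degree-++ u (legEdges 2F) (legEdges 3F ++ [])
            | degree-++ u (legEdges 3F) []
            | degree-legEdges u 0F | degree-legEdges u 1F
            | degree-legEdges u 2F | degree-legEdges u 3F = refl

    -- Both edges start at the centre, so with equal outer ends they would have the same image.
    ends-distinct : ∀ {a b : SpiderEdge (1 ∷ 1 ∷ 1 ∷ l ∷ [])} → a ≢ b →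
      edgeInner a ≡ centre → edgeInner b ≡ centre → toℕ (f (edgeOuter a)) ≢ toℕ (f (edgeOuter b))
    ends-distinct a≢b p q eq = imageEdge-distinct a≢b
      (subst (SameEdge _) (cong₂ (λ x y → toℕ (f x) , y) (trans p (sym q)) eq) same)

    01-distinct : end 0F ≢ end 1F
    01-distinct = ends-distinct {0F , 0F} {1F , 0F} (λ ()) refl refl
    02-distinct : end 0F ≢ end 2F
    02-distinct = ends-distinct {0F , 0F} {2F , 0F} (λ ()) refl refl
    12-distinct : end 1F ≢ end 2F
    12-distinct = ends-distinct {1F , 0F} {2F , 0F} (λ ()) refl refl

  -- The ends of the three short legs are distinct. If the long leg does not end at `end 0F`, that
  -- vertex is the end of exactly one leg; otherwise `end 1F` is.
  oddVertex : ∃ λ u → u < k × degree u imageEdges ≡ true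
  oddVertex with end 0F ≟ end 3F
  ... | no 0≢3 = end 0F , Finₚ.toℕ<n _ , trans (degree≡ (end 0F))
    (parity-1000 (centreImage ≡ᵇ end 0F) (≡ᵇ-true (end 0F)) (≡ᵇ-false (01-distinct ∘ sym))
      (≡ᵇ-false (02-distinct ∘ sym)) (≡ᵇ-false (0≢3 ∘ sym)))
  ... | yes 0≡3 = end 1F , Finₚ.toℕ<n _ , trans (degree≡ (end 1F))
    (parity-0100 (centreImage ≡ᵇ end 1F) (≡ᵇ-false 01-distinct) (≡ᵇ-true (end 1F))
      (≡ᵇ-false (12-distinct ∘ sym)) (≡ᵇ-false λ 3≡1 → 01-distinct (trans 0≡3 3≡1)))

  not-all-edges : odd k ≡ true → length imageEdges ≢ triangle k
  not-all-edges k-odd full with oddVertex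
  ... | u , u<k , eq with trans (sym eq) (trans (sym (degree-imageEdges full u))
                            (trans (degree-completeEdges u<k) (cong not k-odd)))
  ... | ()

-- Binomial coefficients and the two directions of the theorem

triangle≡C : ∀ k → triangle k ≡ suc k C 2
triangle≡C zero    = refl
triangle≡C (suc k) = trans (cong₂ _+_ (sym (nC1≡n (suc k))) (triangle≡C k))
  (nCk+nC[k+1]≡[n+1]C[k+1] (suc k) 1)

Odd⇒order : ∀ {k} → Odd k → ∃ λ h → k ≡ order h
Odd⇒order (m , refl) = m , lemma m
  where
  lemma : ∀ m → suc (2 * m) ≡ order m
  lemma zero    = refl
  lemma (suc m) = trans (cong suc (*-suc 2 m)) (cong (2 +_) (lemma m))


group-legs : ∀ a b c d → a + b + c + d ≡ (a + c) + (b + d)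
group-legs = solve-∀

-- The surplus `o` is added to the second trail, so that the two parts together exhaust the edges of
-- K*_k.
AllTours⇒embeds : ∀ {k l₁ l₂ l₃ l₄ m} → 1 ≤ k → AllTours k → 3 ≤ m → l₁ + l₃ ≤ m → 3 ≤ l₂ + l₄ →
                  m + (l₂ + l₄) ≤ triangle k → EmbedsIn (l₁ ∷ l₂ ∷ l₃ ∷ l₄ ∷ []) k
AllTours⇒embeds {k} {l₂ = l₂} {l₄ = l₄} {m = m} 1≤k T 3≤m le 3≤l₂+l₄ le′ with m≤n⇒∃[o]m+o≡n le′
... | o , eq = tour⇒embeds 1≤k
  (T m (l₂ + l₄ + o) 3≤m (≤-trans 3≤l₂+l₄ (m≤m+n _ o)) (trans (sym (+-assoc m (l₂ + l₄) o)) eq))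
  le (m≤m+n (l₂ + l₄) o)

theorem2p10 : (k : ℕ) → 1 ≤ k → Odd k →
    (l₁ l₂ l₃ l₄ : ℕ) → 1 ≤ l₁ → l₁ ≤ l₂ → l₂ ≤ l₃ → l₃ ≤ l₄ →
    7 ≤ l₁ + l₂ + l₃ + l₄ →
    (EmbedsIn (l₁ ∷ l₂ ∷ l₃ ∷ l₄ ∷ []) k ⇔
    ((l₃ ≡ 1 × l₁ + l₂ + l₃ + l₄ ≤ (suc k C 2) ∸ 1)
    ⊎ (2 ≤ l₃ × l₁ + l₂ + l₃ + l₄ ≤ suc k C 2)))
theorem2p10 k 1≤k k-odd l₁ l₂ l₃ l₄ 1≤l₁ l₁≤l₂ l₂≤l₃ l₃≤l₄ 7≤n
  rewrite sym (triangle≡C k) with Odd⇒order k-odd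
... | h , refl = mk⇔ necessary (sufficient h)
  where
  1≤l₂ = ≤-trans 1≤l₁ l₁≤l₂
  1≤l₃ = ≤-trans 1≤l₂ l₂≤l₃

  necessary : EmbedsIn (l₁ ∷ l₂ ∷ l₃ ∷ l₄ ∷ []) (order h) →
    (l₃ ≡ 1 × l₁ + l₂ + l₃ + l₄ ≤ triangle (order h) ∸ 1)
    ⊎ (2 ≤ l₃ × l₁ + l₂ + l₃ + l₄ ≤ triangle (order h))
  necessary (f , f-embeds) with m≤n⇒m<n∨m≡n 1≤l₃
  ... | inj₁ 2≤l₃ = inj₂ (2≤l₃ , embeds⇒≤triangle f f-embeds)
  -- From `l₃` = 1 it follows that `l₁` = `l₂` = 1, the case covered by `not-all-edges`.
  ... | inj₂ refl with ≤-antisym l₂≤l₃ 1≤l₂ | ≤-antisym (≤-trans l₁≤l₂ l₂≤l₃) 1≤l₁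
  ... | refl | refl = inj₁ (refl , ≤-pred-strict (≤∧≢⇒< (embeds⇒≤triangle f f-embeds)
    λ full → not-all-edges f f-embeds (odd-order h) (trans (imageEdges-length₄ f f-embeds) full)))
    where
    ≤-pred-strict : ∀ {m n} → m < n → m ≤ n ∸ 1
    ≤-pred-strict (s≤s m≤n) = m≤n

  n = l₁ + l₂ + l₃ + l₄

  sufficient : ∀ h → (l₃ ≡ 1 × n ≤ triangle (order h) ∸ 1) ⊎ (2 ≤ l₃ × n ≤ triangle (order h)) →
    EmbedsIn (l₁ ∷ l₂ ∷ l₃ ∷ l₄ ∷ []) (order h)
  -- K*_1 and K*_3 have 1 and 6 edges, too few for n ≥ 7.
  sufficient zero          (inj₁ (_ , n≤)) = contradiction (≤-trans 7≤n n≤) (from-no (7 ≤? 0))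
  sufficient zero          (inj₂ (_ , n≤)) = contradiction (≤-trans 7≤n n≤) (from-no (7 ≤? 1))
  sufficient (suc zero)    (inj₁ (_ , n≤)) = contradiction (≤-trans 7≤n n≤) (from-no (7 ≤? 5))
  sufficient (suc zero)    (inj₂ (_ , n≤)) = contradiction (≤-trans 7≤n n≤) (from-no (7 ≤? 6))
  sufficient (suc (suc g)) (inj₁ (refl , n≤))
    with ≤-antisym l₂≤l₃ 1≤l₂ | ≤-antisym (≤-trans l₁≤l₂ l₂≤l₃) 1≤l₁
  -- Legs 1 and 3 have only two edges together, but a first part needs three. The additional edge is
  -- the one kept free by n ≤ `triangle k` - 1.
  ... | refl | refl = AllTours⇒embeds (s≤s z≤n) (tours g) (≤-refl {3}) (s≤s (s≤s z≤n))
    (≤-trans (from-yes (3 ≤? 5)) (s≤s⁻¹ (s≤s⁻¹ 7≤n))) (s≤s n≤)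
  -- Pairing leg 1 with leg 3 and leg 2 with leg 4 puts a leg of length at least 2 into each pair,
  -- so both parts have at least 3 edges.
  sufficient (suc (suc g)) (inj₂ (2≤l₃ , n≤)) = AllTours⇒embeds (1≤order (2 + g)) (tours g)
    (+-mono-≤ 1≤l₁ 2≤l₃) ≤-refl (+-mono-≤ 1≤l₂ (≤-trans 2≤l₃ l₃≤l₄))
    (≤-trans (≤-reflexive (sym (group-legs l₁ l₂ l₃ l₄))) n≤)
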